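{- As Laurent series in $z$, $$\sum_{n\ge0}\binom{2n}{n}z^n=\left(9\frac{1+z}{1-z}+3\right)\Psi(-z)-(4z+8)\Psi^3(-z)-\left(12z^2+12z+3\right)\Psi^5(-z)\quad\text{modulo }27.$$
   Context: $\Psi(z)=\prod_{j\ge0}(1+z^{3^j})$, so $\Psi(-z)=\prod_{j\ge0}(1-z^{3^j})$. Rational functions are expanded as power series in $z$; "modulo $27$" means coefficientwise congruence. -}

module Defs where

open import Data.Bool.Base using (Bool; true; false; if_then_else_; T)
open import Data.Fin.Base using (toℕ)
import Data.Fin.Properties as Fin
open import Data.Integer.Base as ℤ using (ℤ; +_; 0ℤ; 1ℤ; -1ℤ)
open import Data.Integer.Divisibility using (_∣_)
import Data.Integer.Properties as ℤ
open import Data.Nat.Base as ℕ using (ℕ; zero; suc; _∸_; _≡ᵇ_; _≤_; _<_; z≤n; s≤s)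
import Data.Nat.Properties as ℕ
open import Data.Unit.Base using (tt)
open import Relation.Binary.PropositionalEquality
  using (_≡_; _≗_; refl; sym; trans; cong; cong₂; subst; module ≡-Reasoning)
open import Relation.Nullary.Negation.Core using (contradiction)

open import Algebra.Properties.Semiring.Sum ℤ.+-*-semiring public
  using (sum; sum-syntax; sum⁺-syntax; sum-cong-≗; sum-replicate-zero)

-- Formal power series over ℤ in z; f n is the coefficient of z^n.
PowerSeries : Set
PowerSeries = ℕ → ℤ

infix  4 _≈_⟨mod_⟩
infixl 6 _+_ _-_
infixl 7 _*_
infixr 8 _^_
infixl 9 _⟨-z⟩
infix  10 z^_

_+_ : PowerSeries → PowerSeries → PowerSeries
(f + g) n = f n ℤ.+ g n

_-_ : PowerSeries → PowerSeries → PowerSeries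
(f - g) n = f n ℤ.- g n

_*_ : PowerSeries → PowerSeries → PowerSeries
(f * g) n = ∑[ i ≤ n ] (f (toℕ i) ℤ.* g (n ∸ toℕ i))

con : ℤ → PowerSeries
con c zero    = c
con c (suc _) = 0ℤ

_^_ : PowerSeries → ℕ → PowerSeries
f ^ zero  = con 1ℤ
f ^ suc k = f * f ^ k

z^_ : ℕ → PowerSeries
(z^ k) n = if n ≡ᵇ k then 1ℤ else 0ℤ

z : PowerSeries
z = z^ 1

-- The substitution z ↦ -z.
_⟨-z⟩ : PowerSeries → PowerSeries
(f ⟨-z⟩) n = (-1ℤ ℤ.^ n) ℤ.* f n

-- The expansion of 1/(1 - z); see [1-z]*1/[1-z].
1/[1-z] : PowerSeries
1/[1-z] _ = 1ℤ

_≈_⟨mod_⟩ : PowerSeries → PowerSeries → ℕ → Set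
f ≈ g ⟨mod m ⟩ = ∀ n → + m ∣ f n ℤ.- g n

-- ∏_{j < m} (1 + z^(3^j))
Ψ-partial : ℕ → PowerSeries
Ψ-partial zero    = con 1ℤ
Ψ-partial (suc m) = (con 1ℤ + z^ (3 ℕ.^ m)) * Ψ-partial m

-- The infinite product: since 3^j > n for j ≥ n, the coefficient of z^n is
-- already that of the product of the first n factors; see Ψ-limit.
Ψ : PowerSeries
Ψ n = Ψ-partial n n

private
  <⇒≡ᵇ-false : ∀ {m n} → m < n → (m ≡ᵇ n) ≡ false
  <⇒≡ᵇ-false {m} {n} m<n with m ≡ᵇ n in eq
  ... | false = refl
  ... | true  = contradiction (ℕ.≡ᵇ⇒≡ m n (subst T (sym eq) tt)) (ℕ.<⇒≢ m<n)

  z^-low : ∀ {k n} → n < k → (z^ k) n ≡ 0ℤ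
  z^-low n<k = cong (if_then 1ℤ else 0ℤ) (<⇒≡ᵇ-false n<k)

  *-factor-low : ∀ {k n} (f : PowerSeries) → n < k → ((con 1ℤ + z^ k) * f) n ≡ f n
  *-factor-low {k} {n} f n<k = begin
    ((con 1ℤ + z^ k) * f) n
      ≡⟨ cong₂ ℤ._+_
           (trans (cong (λ x → (1ℤ ℤ.+ x) ℤ.* f n) (z^-low (ℕ.≤-<-trans z≤n n<k)))
                  (ℤ.*-identityˡ (f n)))
           (trans (sum-cong-≗ {n} λ i →
                     cong (λ x → (0ℤ ℤ.+ x) ℤ.* f (n ∸ suc (toℕ i)))
                          (z^-low (ℕ.≤-<-trans (Fin.toℕ<n i) n<k)))
                  (sum-replicate-zero n)) ⟩
    f n ℤ.+ 0ℤ
      ≡⟨ ℤ.+-identityʳ (f n) ⟩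
    f n ∎
    where open ≡-Reasoning

  n<3^n : ∀ n → n < 3 ℕ.^ n
  n<3^n zero    = s≤s z≤n
  n<3^n (suc n) =
    ℕ.≤-trans (ℕ.+-mono-≤ (ℕ.≤-trans (s≤s z≤n) (n<3^n n)) (n<3^n n))
              (ℕ.+-monoʳ-≤ (3 ℕ.^ n) (ℕ.m≤m+n (3 ℕ.^ n) _))

Ψ-limit : ∀ {m n} → n ≤ m → Ψ-partial m n ≡ Ψ n
Ψ-limit n≤m = go (ℕ.≤⇒≤′ n≤m)
  where
  go : ∀ {m n} → n ℕ.≤′ m → Ψ-partial m n ≡ Ψ n
  go ℕ.≤′-refl = refl
  go {suc m} {n} (ℕ.≤′-step n≤′m) =
    trans (*-factor-low (Ψ-partial m)
            (ℕ.≤-<-trans (ℕ.≤′⇒≤ n≤′m) (n<3^n m)))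
          (go n≤′m)

[1-z]*1/[1-z] : (con 1ℤ - z) * 1/[1-z] ≗ con 1ℤ
[1-z]*1/[1-z] zero    = refl
[1-z]*1/[1-z] (suc n) = cong (λ x → 1ℤ ℤ.+ (-1ℤ ℤ.+ x)) (sum-replicate-zero n)

{-# OPTIONS --safe #-}
module Submission where

-- Write F for the generating function of the central binomial coefficients and G for the right-hand
-- side. Since (1 + x)³ ≡ 1 + x³ modulo 3, the partial products of (1 + z) Ψ² telescope, so that
-- (1 - z) Ψ(-z)² = 1 + 3e for an integral series e. Expressed through e, (1 - z)⁵ (1 - 4z) G² agrees
-- with (1 - z)⁵ modulo 27. On the other hand (1 - 4z) F² = 1, because z d/dz annihilates it. Hence
-- (1 - z)⁵ (1 - 4z) (F + G) (F - G) ≡ 0 modulo 27, and all factors but F - G have a product with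
-- constant term 2, which is prime to 27, so they cancel.

open import Algebra.Bundles using (CommutativeRing)
import Algebra.Consequences.Setoid as Consequences
import Algebra.Construct.Pointwise as Pointwise
import Algebra.Solver.Ring
open import Algebra.Solver.Ring.AlmostCommutativeRing
  using (fromCommutativeRing; _-Raw-AlmostCommutative⟶_)
open import Data.Integer.Base as ℤ using (ℤ; +_; 0ℤ; 1ℤ; -1ℤ)
open import Data.Integer.Coprimality using (Coprime; coprime-divisor; coprime?)
open import Data.Integer.Divisibility using (_∣_)
import Data.Integer.Divisibility.Signed as Signed
import Data.Integer.Properties as ℤ
open import Data.Integer.Tactic.RingSolver using (solve-∀)
import Data.Maybe.Base as Maybe
open import Data.Nat.Base as ℕ using (ℕ; zero; suc; _!)
open import Data.Nat.Combinatorics using (_C_; k![n∸k]!∣n!)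
open import Data.Nat.Combinatorics.Specification using (nCk≡n!/k![n-k]!)
open import Data.Nat.DivMod using (m/n*n≡m)
open import Data.Nat.Induction using (<-rec)
import Data.Nat.Properties as ℕ
import Data.Nat.Tactic.RingSolver as ℕ-Solver
open import Data.Product.Base using (_,_; ∃; proj₁; proj₂)
open import Data.Sum.Base using (inj₂)
open import Function.Base using (_∘_)
open import Level using (0ℓ)
open import Relation.Binary.PropositionalEquality
  using (_≡_; _≗_; refl; sym; trans; cong; cong₂; subst; _→-setoid_; module ≡-Reasoning)
open import Relation.Nullary.Decidable using (dec⇒maybe; toWitness)

-- Ring identities over an abstract commutative ring.

-- Over an abstract ring the solver compares normal forms symbolically; over power series the
-- type checker would unfold them into coefficient sums.
module Identities (R : CommutativeRing 0ℓ 0ℓ)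
  (ℤ⟶R : ℤ.+-*-rawRing -Raw-AlmostCommutative⟶ fromCommutativeRing R) where

  open CommutativeRing R renaming (refl to ≈-refl; trans to ≈-trans)
  open _-Raw-AlmostCommutative⟶_ ℤ⟶R using () renaming (⟦_⟧ to con)

  con≟ : ∀ a b → Maybe.Maybe (con a ≈ con b)
  con≟ a b = Maybe.map (λ { refl → ≈-refl }) (dec⇒maybe (a ℤ.≟ b))

  open Algebra.Solver.Ring ℤ.+-*-rawRing (fromCommutativeRing R) ℤ⟶R con≟
    using (solve; _:=_; _:+_; _:*_; _:-_; :-_) renaming (con to κ)
  open import Relation.Binary.Reasoning.Setoid setoid

  partial-product-base : ∀ z →
    (con 1ℤ + z) * (con 1ℤ * con 1ℤ) ≈ con 1ℤ + z + con (+ 3) * con 0ℤ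
  partial-product-base =
    solve 1 (λ z → (κ 1ℤ :+ z) :* (κ 1ℤ :* κ 1ℤ) := κ 1ℤ :+ z :+ κ (+ 3) :* κ 0ℤ) ≈-refl

  -- The factor (1 + x)² turns 1 + x into (1 + x)³ = 1 + x³ + 3 (x + x²). The cube is written as
  -- `_^_` unfolds it, and `x³` is separate because z^(3^(m+1)) equals the cube of z^(3^m) only
  -- coefficientwise.
  partial-product-step : ∀ z x ψ e {x³} → x * (x * (x * con 1ℤ)) ≈ x³ →
    (con 1ℤ + z) * (ψ * ψ) ≈ con 1ℤ + x + con (+ 3) * e →
    (con 1ℤ + z) * ((con 1ℤ + x) * ψ * ((con 1ℤ + x) * ψ)) ≈
      con 1ℤ + x³ + con (+ 3) * (x + x * x + (con 1ℤ + x) * (con 1ℤ + x) * e)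
  partial-product-step z x ψ e {x³} cube hyp = begin
    (con 1ℤ + z) * ((con 1ℤ + x) * ψ * ((con 1ℤ + x) * ψ))
      ≈⟨ solve 3 (λ z x ψ → (κ 1ℤ :+ z) :* ((κ 1ℤ :+ x) :* ψ :* ((κ 1ℤ :+ x) :* ψ)) :=
           (κ 1ℤ :+ x) :* (κ 1ℤ :+ x) :* ((κ 1ℤ :+ z) :* (ψ :* ψ))) ≈-refl z x ψ ⟩
    (con 1ℤ + x) * (con 1ℤ + x) * ((con 1ℤ + z) * (ψ * ψ))
      ≈⟨ *-congˡ hyp ⟩
    (con 1ℤ + x) * (con 1ℤ + x) * (con 1ℤ + x + con (+ 3) * e)
      ≈⟨ solve 2 (λ x e → (κ 1ℤ :+ x) :* (κ 1ℤ :+ x) :* (κ 1ℤ :+ x :+ κ (+ 3) :* e) :=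
           κ 1ℤ :+ x :* (x :* (x :* κ 1ℤ)) :+
             κ (+ 3) :* (x :+ x :* x :+ (κ 1ℤ :+ x) :* (κ 1ℤ :+ x) :* e)) ≈-refl x e ⟩
    con 1ℤ + x * (x * (x * con 1ℤ)) + con (+ 3) * (x + x * x + (con 1ℤ + x) * (con 1ℤ + x) * e)
      ≈⟨ +-congʳ (+-congˡ cube) ⟩
    con 1ℤ + x³ + con (+ 3) * (x + x * x + (con 1ℤ + x) * (con 1ℤ + x) * e) ∎

  [1-4z]*f : ∀ z f → (con 1ℤ - con (+ 4) * z) * f ≈ f - con (+ 4) * (z * f)
  [1-4z]*f = solve 2 (λ z f → (κ 1ℤ :- κ (+ 4) :* z) :* f := f :- κ (+ 4) :* (z :* f)) ≈-refl

  -- Read f′ as z df/dz: the left side is then the product rule for (1 - 4z) f², with -4z the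
  -- derivative of 1 - 4z.
  derivative-of-[1-4z]f² : ∀ z f f′ → (con 1ℤ - con (+ 4) * z) * f′ ≈ con (+ 2) * (z * f) →
    - (con (+ 4) * z) * (f * f) + (con 1ℤ - con (+ 4) * z) * (f′ * f + f * f′) ≈ con 0ℤ
  derivative-of-[1-4z]f² z f f′ hyp = begin
    - (con (+ 4) * z) * (f * f) + (con 1ℤ - con (+ 4) * z) * (f′ * f + f * f′)
      ≈⟨ solve 3 (λ z f f′ →
           :- (κ (+ 4) :* z) :* (f :* f) :+ (κ 1ℤ :- κ (+ 4) :* z) :* (f′ :* f :+ f :* f′) :=
           :- (κ (+ 4) :* z) :* (f :* f) :+ κ (+ 2) :* f :* ((κ 1ℤ :- κ (+ 4) :* z) :* f′))
           ≈-refl z f f′ ⟩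
    - (con (+ 4) * z) * (f * f) + con (+ 2) * f * ((con 1ℤ - con (+ 4) * z) * f′)
      ≈⟨ +-congˡ (*-congˡ hyp) ⟩
    - (con (+ 4) * z) * (f * f) + con (+ 2) * f * (con (+ 2) * (z * f))
      ≈⟨ solve 2 (λ z f → :- (κ (+ 4) :* z) :* (f :* f) :+ κ (+ 2) :* f :* (κ (+ 2) :* (z :* f)) :=
           κ 0ℤ) ≈-refl z f ⟩
    con 0ℤ ∎

  -- Clearing denominators and the congruence modulo 27.

  module _ (z : Carrier) where

    private d = con 1ℤ - z

    -- This is (1 - z)² G / p for p = Ψ(-z), written in v = (1 - z) · 1/(1 - z) and s = (1 - z) p².
    -- Later v becomes 1 and s becomes 1 + 3e.
    cleared : Carrier → Carrier → Carrier → Carrier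
    cleared v s z² =
      (con (+ 9) * ((con 1ℤ + z) * v) + con (+ 3) * d) * d
      - (con (+ 4) * z + con (+ 8)) * (d * s)
      - (con (+ 12) * z² + con (+ 12) * z + con (+ 3)) * (s * s)

    cleared-cong : ∀ {v v′ s s′ t t′} → v ≈ v′ → s ≈ s′ → t ≈ t′ → cleared v s t ≈ cleared v′ s′ t′
    cleared-cong v s t = +-cong
      (+-cong (*-congʳ (+-congʳ (*-congˡ (*-congˡ v)))) (-‿cong (*-congˡ (*-congˡ s))))
      (-‿cong (*-cong (+-congʳ (+-congʳ (*-congˡ t))) (*-cong s s)))

    cofactor : Carrier → Carrier
    cofactor e =
      let w  = z + z * z
          c  = con 1ℤ - con (+ 4) * z
          a₀ = con 1ℤ - con (+ 14) * w
          a₁ = - (con (+ 14) + con (+ 20) * w)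
          b  = (con 1ℤ + con (+ 4) * w) * (e * e)
      in
      -- This quintic is ((1 - z)⁵ - (1 - 4z) a₀²) / 27.
      z - con (+ 10) * (z * z) + con (+ 10) * (z * z * z) + con (+ 51) * (z * z * (z * z))
        + con (+ 29) * (z * z * (z * z) * z)
      + c * (con (+ 3) * e * a₀ * (con 1ℤ + con (+ 2) * w)
        + con (+ 4) * (e * e) * a₁ * (con 1ℤ + con (+ 4) * w)
        - e * e * e * (a₁ * a₁)
        -- The contribution of -27 b to the square of the cleared combination.
        + (con 1ℤ + con (+ 3) * e) * b * (con (+ 2) * (a₀ + con (+ 3) * e * a₁) - con (+ 27) * b))

    -- With w = z + z², the cleared combination is a₀ + 3 a₁ e - 27 b. Modulo 27 only
    -- (1 - z)⁵ - (1 - 4z) a₀², 3 e a₀ (a₀ + 2 a₁), 9 e² a₁ (2 a₀ + a₁) and 27 e³ a₁² remain,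
    -- where a₀ + 2 a₁ = -27 (1 + 2w) and 2 a₀ + a₁ = -12 (1 + 4w).
    cofactor-spec : ∀ e → let s = con 1ℤ + con (+ 3) * e in
      d * (d * d * (d * d)) * con 1ℤ
        - (con 1ℤ - con (+ 4) * z) * (s * (cleared (con 1ℤ) s (z * z) * cleared (con 1ℤ) s (z * z)))
      ≈ con (+ 27) * cofactor e
    cofactor-spec = solve 2 (λ z e →
      let d  = κ 1ℤ :- z
          s  = κ 1ℤ :+ κ (+ 3) :* e
          c  = κ 1ℤ :- κ (+ 4) :* z
          w  = z :+ z :* z
          a₀ = κ 1ℤ :- κ (+ 14) :* w
          a₁ = :- (κ (+ 14) :+ κ (+ 20) :* w)
          b  = (κ 1ℤ :+ κ (+ 4) :* w) :* (e :* e)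
          a  = (κ (+ 9) :* ((κ 1ℤ :+ z) :* κ 1ℤ) :+ κ (+ 3) :* d) :* d
            :- (κ (+ 4) :* z :+ κ (+ 8)) :* (d :* s)
            :- (κ (+ 12) :* (z :* z) :+ κ (+ 12) :* z :+ κ (+ 3)) :* (s :* s)
      in
      d :* (d :* d :* (d :* d)) :* κ 1ℤ :- c :* (s :* (a :* a)) :=
      κ (+ 27) :* (
        z :- κ (+ 10) :* (z :* z) :+ κ (+ 10) :* (z :* z :* z) :+ κ (+ 51) :* (z :* z :* (z :* z))
          :+ κ (+ 29) :* (z :* z :* (z :* z) :* z)
        :+ c :* (κ (+ 3) :* e :* a₀ :* (κ 1ℤ :+ κ (+ 2) :* w)
          :+ κ (+ 4) :* (e :* e) :* a₁ :* (κ 1ℤ :+ κ (+ 4) :* w)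
          :- e :* e :* e :* (a₁ :* a₁)
          :+ (κ 1ℤ :+ κ (+ 3) :* e) :* b :*
             (κ (+ 2) :* (a₀ :+ κ (+ 3) :* e :* a₁) :- κ (+ 27) :* b))))
      ≈-refl z

  module _ (z z² u p : Carrier) where

    private d = con 1ℤ - z

    -- The right-hand side of the theorem, with u for 1/(1 - z) and p for Ψ(-z). Powers of p are
    -- spelled out as `_^_` unfolds them, so that the instance over power series agrees with the
    -- theorem by computation.
    combination : Carrier
    combination =
      (con (+ 9) * ((con (+ 1) + z) * u) + con (+ 3)) * p
      - (con (+ 4) * z + con (+ 8)) * (p * (p * (p * con 1ℤ)))
      - (con (+ 12) * z² + con (+ 12) * z + con (+ 3)) * (p * (p * (p * (p * (p * con 1ℤ)))))

    -- Only odd powers of p occur. After one p is taken out, at most (p²)² remains, and two factors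
    -- 1 - z turn every p² into (1 - z) p².
    combination-cleared : d * d * combination ≈ p * cleared z (d * u) (d * (p * p)) z²
    combination-cleared = solve 4 (λ z z² u p →
      let d = κ 1ℤ :- z in
      d :* d :* ((κ (+ 9) :* ((κ (+ 1) :+ z) :* u) :+ κ (+ 3)) :* p
        :- (κ (+ 4) :* z :+ κ (+ 8)) :* (p :* (p :* (p :* κ 1ℤ)))
        :- (κ (+ 12) :* z² :+ κ (+ 12) :* z :+ κ (+ 3)) :* (p :* (p :* (p :* (p :* (p :* κ 1ℤ))))))
      := p :* ((κ (+ 9) :* ((κ 1ℤ :+ z) :* (d :* u)) :+ κ (+ 3) :* d) :* d
        :- (κ (+ 4) :* z :+ κ (+ 8)) :* (d :* (d :* (p :* p)))
        :- (κ (+ 12) :* z² :+ κ (+ 12) :* z :+ κ (+ 3)) :* (d :* (p :* p) :* (d :* (p :* p)))))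
      ≈-refl z z² u p

    -- The exponent 5 is 2 + 2 + 1: (1 - z)² clears each copy of g, leaving p² a², and the last 1 -
    -- z combines with p² into 1 + 3e.
    cleared-difference-of-squares : ∀ f e →
      z² ≈ z * z →
      d * u ≈ con 1ℤ →
      d * (p * p) ≈ con 1ℤ + con (+ 3) * e →
      (con 1ℤ - con (+ 4) * z) * (f * f) ≈ con 1ℤ →
      ((con 1ℤ - con (+ 4) * z) * (f + combination) * (d * (d * d * (d * d)))) * (f - combination)
        ≈ con (+ 27) * cofactor z e
    cleared-difference-of-squares f e z²≈ u≈ p≈ f≈ = begin
      (c * (f + g) * d⁵) * (f - g)
        ≈⟨ solve 4 (λ c d f g →
             (c :* (f :+ g) :* (d :* (d :* d :* (d :* d)))) :* (f :- g) :=
             d :* (d :* d :* (d :* d)) :* (c :* (f :* f)) :- c :* (d :* (d :* d :* g :* (d :* d :* g))))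
             ≈-refl c d f g ⟩
      d⁵ * (c * (f * f)) - c * (d * (d * d * g * (d * d * g)))
        ≈⟨ +-cong (*-congˡ f≈) (-‿cong (*-congˡ (*-congˡ (*-cong g≈ g≈)))) ⟩
      d⁵ * con 1ℤ - c * (d * (p * a * (p * a)))
        ≈⟨ +-congˡ (-‿cong (*-congˡ (solve 3 (λ d p a →
             d :* (p :* a :* (p :* a)) := d :* (p :* p) :* (a :* a)) ≈-refl d p a))) ⟩
      d⁵ * con 1ℤ - c * (d * (p * p) * (a * a))
        ≈⟨ +-congˡ (-‿cong (*-congˡ (*-congʳ p≈))) ⟩
      d⁵ * con 1ℤ - c * ((con 1ℤ + con (+ 3) * e) * (a * a))
        ≈⟨ cofactor-spec z e ⟩
      con (+ 27) * cofactor z e ∎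
      where
      c  = con 1ℤ - con (+ 4) * z
      d⁵ = d * (d * d * (d * d))
      g  = combination
      a  = cleared z (con 1ℤ) (con 1ℤ + con (+ 3) * e) (z * z)
      g≈ : d * d * g ≈ p * a
      g≈ = ≈-trans combination-cleared (*-congˡ (cleared-cong z u≈ p≈ z²≈))

open import Defs

-- The commutative ring of power series.

private
  variable
    f f₁ f₂ g g₁ g₂ : PowerSeries

tail : PowerSeries → PowerSeries
tail f = f ∘ suc

infix 8 -_
-_ : PowerSeries → PowerSeries
(- f) n = ℤ.- f n

-- The mirror image of (f * g) (suc n) = f 0 g (suc n) + (tail f * g) n, which holds definitionally
-- and drives the inductions below.
*-tailʳ : ∀ f g n → (f * g) (suc n) ≡ f (suc n) ℤ.* g 0 ℤ.+ (f * tail g) n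
*-tailʳ f g zero    = lemma (f 0) (f 1) (g 0) (g 1)
  where
  lemma : ∀ a b c d → a ℤ.* d ℤ.+ (b ℤ.* c ℤ.+ 0ℤ) ≡ b ℤ.* c ℤ.+ (a ℤ.* d ℤ.+ 0ℤ)
  lemma = solve-∀
*-tailʳ f g (suc n) = begin
  f 0 ℤ.* g (2 ℕ.+ n) ℤ.+ (tail f * g) (suc n)
    ≡⟨ cong (λ x → f 0 ℤ.* g (2 ℕ.+ n) ℤ.+ x) (*-tailʳ (tail f) g n) ⟩
  f 0 ℤ.* g (2 ℕ.+ n) ℤ.+ (f (2 ℕ.+ n) ℤ.* g 0 ℤ.+ (tail f * tail g) n)
    ≡⟨ lemma (f 0 ℤ.* g (2 ℕ.+ n)) (f (2 ℕ.+ n) ℤ.* g 0) _ ⟩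
  f (2 ℕ.+ n) ℤ.* g 0 ℤ.+ (f * tail g) (suc n) ∎
  where
  open ≡-Reasoning
  lemma : ∀ a b c → a ℤ.+ (b ℤ.+ c) ≡ b ℤ.+ (a ℤ.+ c)
  lemma = solve-∀

-- Bounded agreement is what the infinite product needs: Ψ matches a partial product only up to a
-- finite degree.
*-cong-≤ : ∀ n → (∀ {k} → k ℕ.≤ n → f₁ k ≡ f₂ k) → (∀ {k} → k ℕ.≤ n → g₁ k ≡ g₂ k) →
           (f₁ * g₁) n ≡ (f₂ * g₂) n
*-cong-≤ zero    p q = cong (ℤ._+ 0ℤ) (cong₂ ℤ._*_ (p ℕ.z≤n) (q ℕ.z≤n))
*-cong-≤ (suc n) p q = cong₂ ℤ._+_ (cong₂ ℤ._*_ (p ℕ.z≤n) (q ℕ.≤-refl))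
  (*-cong-≤ n (p ∘ ℕ.s≤s) (q ∘ ℕ.m≤n⇒m≤1+n))

*-cong : f₁ ≗ f₂ → g₁ ≗ g₂ → f₁ * g₁ ≗ f₂ * g₂
*-cong p q n = *-cong-≤ n (λ {k} _ → p k) (λ {k} _ → q k)

*-congˡ : ∀ f → g₁ ≗ g₂ → f * g₁ ≗ f * g₂
*-congˡ f = *-cong {f₁ = f} (λ _ → refl)

*-congʳ : ∀ g → f₁ ≗ f₂ → f₁ * g ≗ f₂ * g
*-congʳ g p = *-cong {g₁ = g} p (λ _ → refl)

*-comm : ∀ f g → f * g ≗ g * f
*-comm f g zero    = cong (ℤ._+ 0ℤ) (ℤ.*-comm (f 0) (g 0))
*-comm f g (suc n) = begin
  f 0 ℤ.* g (suc n) ℤ.+ (tail f * g) n  ≡⟨ cong₂ ℤ._+_ (ℤ.*-comm (f 0) _) (*-comm (tail f) g n) ⟩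
  g (suc n) ℤ.* f 0 ℤ.+ (g * tail f) n  ≡⟨ *-tailʳ g f n ⟨
  (g * f) (suc n) ∎
  where open ≡-Reasoning

*-distribʳ-+ : ∀ h f g → (f + g) * h ≗ f * h + g * h
*-distribʳ-+ h f g zero    = lemma (f 0) (g 0) (h 0)
  where
  lemma : ∀ a b c → (a ℤ.+ b) ℤ.* c ℤ.+ 0ℤ ≡ a ℤ.* c ℤ.+ 0ℤ ℤ.+ (b ℤ.* c ℤ.+ 0ℤ)
  lemma = solve-∀
*-distribʳ-+ h f g (suc n) = trans
  (cong (λ x → (f 0 ℤ.+ g 0) ℤ.* h (suc n) ℤ.+ x) (*-distribʳ-+ h (tail f) (tail g) n))
  (lemma (f 0) (g 0) (h (suc n)) _ _)
  where
  lemma : ∀ a b c d e → (a ℤ.+ b) ℤ.* c ℤ.+ (d ℤ.+ e) ≡ a ℤ.* c ℤ.+ d ℤ.+ (b ℤ.* c ℤ.+ e)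
  lemma = solve-∀

scale : ℤ → PowerSeries → PowerSeries
scale c f n = c ℤ.* f n

scale-*ˡ : ∀ c f g → scale c f * g ≗ scale c (f * g)
scale-*ˡ c f g zero    = lemma c (f 0) (g 0)
  where
  lemma : ∀ c a b → c ℤ.* a ℤ.* b ℤ.+ 0ℤ ≡ c ℤ.* (a ℤ.* b ℤ.+ 0ℤ)
  lemma = solve-∀
scale-*ˡ c f g (suc n) = trans
  (cong (λ x → c ℤ.* f 0 ℤ.* g (suc n) ℤ.+ x) (scale-*ˡ c (tail f) g n))
  (lemma c (f 0) (g (suc n)) _)
  where
  lemma : ∀ c a b d → c ℤ.* a ℤ.* b ℤ.+ c ℤ.* d ≡ c ℤ.* (a ℤ.* b ℤ.+ d)
  lemma = solve-∀

*-assoc : ∀ f g h → (f * g) * h ≗ f * (g * h)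
*-assoc f g h zero    = lemma (f 0) (g 0) (h 0)
  where
  lemma : ∀ a b c → (a ℤ.* b ℤ.+ 0ℤ) ℤ.* c ℤ.+ 0ℤ ≡ a ℤ.* (b ℤ.* c ℤ.+ 0ℤ) ℤ.+ 0ℤ
  lemma = solve-∀
*-assoc f g h (suc n) = begin
  -- `tail (f * g)` computes to `scale (f 0) (tail g) + tail f * g`.
  (f * g) 0 ℤ.* h (suc n) ℤ.+ ((scale (f 0) (tail g) + tail f * g) * h) n
    ≡⟨ cong (λ x → (f * g) 0 ℤ.* h (suc n) ℤ.+ x)
         (*-distribʳ-+ h (scale (f 0) (tail g)) (tail f * g) n) ⟩
  (f * g) 0 ℤ.* h (suc n) ℤ.+ ((scale (f 0) (tail g) * h) n ℤ.+ ((tail f * g) * h) n)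
    ≡⟨ cong (λ x → (f * g) 0 ℤ.* h (suc n) ℤ.+ x)
         (cong₂ ℤ._+_ (scale-*ˡ (f 0) (tail g) h n) (*-assoc (tail f) g h n)) ⟩
  (f * g) 0 ℤ.* h (suc n) ℤ.+ (f 0 ℤ.* (tail g * h) n ℤ.+ (tail f * (g * h)) n)
    ≡⟨ lemma (f 0) (g 0) (h (suc n)) _ _ ⟩
  (f * (g * h)) (suc n) ∎
  where
  open ≡-Reasoning
  lemma : ∀ a b c d e → (a ℤ.* b ℤ.+ 0ℤ) ℤ.* c ℤ.+ (a ℤ.* d ℤ.+ e) ≡ a ℤ.* (b ℤ.* c ℤ.+ d) ℤ.+ e
  lemma = solve-∀

0-*ˡ : ∀ g → (λ _ → 0ℤ) * g ≗ λ _ → 0ℤ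
0-*ˡ g n = sum-replicate-zero (suc n)

con-* : ∀ c g → con c * g ≗ scale c g
con-* c g zero    = ℤ.+-identityʳ _
con-* c g (suc n) = trans (cong (λ x → c ℤ.* g (suc n) ℤ.+ x) (0-*ˡ g n)) (ℤ.+-identityʳ _)

*-identityˡ : ∀ f → con 1ℤ * f ≗ f
*-identityˡ f n = trans (con-* 1ℤ f n) (ℤ.*-identityˡ (f n))

powerSeriesRing : CommutativeRing 0ℓ 0ℓ
powerSeriesRing = record
  { Carrier = PowerSeries
  ; _≈_     = _≗_
  ; _+_     = _+_
  ; _*_     = _*_
  ; -_      = -_
  ; 0#      = λ _ → 0ℤ
  ; 1#      = con 1ℤ
  ; isCommutativeRing = record
    { isRing = record
      { +-isAbelianGroup = Pointwise.isAbelianGroup ℕ ℤ.+-0-isAbelianGroup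
      ; *-cong           = *-cong
      ; *-assoc          = *-assoc
      ; *-identity       = comm∧idˡ⇒id *-comm *-identityˡ
      ; distrib          = comm∧distrʳ⇒distr (λ p q n → cong₂ ℤ._+_ (p n) (q n)) *-comm *-distribʳ-+
      }
    ; *-comm = *-comm
    }
  }
  where open Consequences (ℕ →-setoid ℤ)

con-+ : ∀ a b → con (a ℤ.+ b) ≗ con a + con b
con-+ a b zero    = refl
con-+ a b (suc n) = refl

con-neg : ∀ a → con (ℤ.- a) ≗ - con a
con-neg a zero    = refl
con-neg a (suc n) = refl

con-homo-* : ∀ a b → con (a ℤ.* b) ≗ con a * con b
con-homo-* a b n = sym (trans (con-* a (con b) n) (lemma n))
  where
  lemma : scale a (con b) ≗ con (a ℤ.* b)
  lemma zero    = refl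
  lemma (suc n) = ℤ.*-zeroʳ a

con-0 : con 0ℤ ≗ λ _ → 0ℤ
con-0 zero    = refl
con-0 (suc n) = refl

con-homomorphism : ℤ.+-*-rawRing -Raw-AlmostCommutative⟶ fromCommutativeRing powerSeriesRing
con-homomorphism = record
  { ⟦_⟧    = con
  ; +-homo = con-+
  ; *-homo = con-homo-*
  ; -‿homo = con-neg
  ; 0-homo = con-0
  ; 1-homo = λ _ → refl
  }

open Identities powerSeriesRing con-homomorphism
module PS = CommutativeRing powerSeriesRing

-- Monomials.

z^-+ : ∀ a b → z^ a * z^ b ≗ z^ (a ℕ.+ b)
z^-+ zero b n = trans (*-congʳ (z^ b) z^0 n) (*-identityˡ (z^ b) n)
  where
  z^0 : z^ 0 ≗ con 1ℤ
  z^0 zero    = refl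
  z^0 (suc _) = refl
z^-+ (suc a) b zero    = refl
z^-+ (suc a) b (suc n) = trans (ℤ.+-identityˡ _) (z^-+ a b n)

z^-^ : ∀ k m → (z^ k) ^ m ≗ z^ (m ℕ.* k)
z^-^ k zero    zero    = refl
z^-^ k zero    (suc n) = refl
z^-^ k (suc m) n       =
  trans (*-congˡ (z^ k) (z^-^ k m) n) (z^-+ k (m ℕ.* k) n)

z^-< : ∀ {n k} → n ℕ.< k → (z^ k) n ≡ 0ℤ
z^-< {zero}  {suc k} _            = refl
z^-< {suc n} {suc k} (ℕ.s≤s n<k) = z^-< n<k

z*f-suc : ∀ f n → (z * f) (suc n) ≡ f n
z*f-suc f n = begin
  0ℤ ℤ.* f (suc n) ℤ.+ (z^ 0 * f) n  ≡⟨ ℤ.+-identityˡ _ ⟩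
  (z^ 0 * f) n                       ≡⟨ *-congʳ f (z^-^ 0 0) n ⟨
  (con 1ℤ * f) n                     ≡⟨ *-identityˡ f n ⟩
  f n                                ∎
  where open ≡-Reasoning

-- The square of Ψ modulo 3.

n<3^n : ∀ n → n ℕ.< 3 ℕ.^ n
n<3^n zero    = ℕ.s≤s ℕ.z≤n
n<3^n (suc n) = ℕ.<-≤-trans (ℕ.s<s (n<3^n n))
  (ℕ.^-monoʳ-< 3 (ℕ.s≤s (ℕ.s≤s ℕ.z≤n)) (ℕ.n<1+n n))

-- The factor 1 + z starts the telescoping: each new squared factor replaces z^(3^m) by its cube, at
-- the cost of a multiple of 3.
Ψ-partial²-mod-3 : ∀ m → ∃ λ e →
  (con 1ℤ + z) * (Ψ-partial m * Ψ-partial m) ≗ con 1ℤ + z^ (3 ℕ.^ m) + con (+ 3) * e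
Ψ-partial²-mod-3 zero    = con 0ℤ , partial-product-base z
Ψ-partial²-mod-3 (suc m) with Ψ-partial²-mod-3 m
... | e , hyp = z^ k + z^ k * z^ k + (con 1ℤ + z^ k) * (con 1ℤ + z^ k) * e ,
  partial-product-step z (z^ k) (Ψ-partial m) e (z^-^ k 3) hyp
  where k = 3 ℕ.^ m

Ψ²-mod-3 : ∃ λ e → (con 1ℤ + z) * (Ψ * Ψ) ≗ con 1ℤ + con (+ 3) * e
Ψ²-mod-3 = e , λ n → begin
  ((con 1ℤ + z) * (Ψ * Ψ)) n
    -- Coefficient n involves only coefficients of Ψ up to n, where Ψ equals its n-th partial
    -- product.
    ≡⟨ *-cong-≤ {f₁ = con 1ℤ + z} n (λ _ → refl) (λ {k} k≤n →
         *-cong-≤ k (λ j≤k → Ψ-limit (ℕ.≤-trans j≤k k≤n))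
                    (λ j≤k → Ψ-limit (ℕ.≤-trans j≤k k≤n))) ⟨
  ((con 1ℤ + z) * (Ψ-partial n * Ψ-partial n)) n
    ≡⟨ proj₂ (Ψ-partial²-mod-3 n) n ⟩
  con 1ℤ n ℤ.+ (z^ (3 ℕ.^ n)) n ℤ.+ (con (+ 3) * eₙ n) n
    -- The leftover monomial z^(3^n) has degree above n.
    ≡⟨ cong₂ (λ x y → con 1ℤ n ℤ.+ x ℤ.+ y) (z^-< (n<3^n n)) (con-* (+ 3) (eₙ n) n) ⟩
  con 1ℤ n ℤ.+ 0ℤ ℤ.+ + 3 ℤ.* e n
    ≡⟨ cong₂ ℤ._+_ (ℤ.+-identityʳ (con 1ℤ n)) (sym (con-* (+ 3) e n)) ⟩
  (con 1ℤ + con (+ 3) * e) n ∎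
  where
  open ≡-Reasoning
  eₙ : ℕ → PowerSeries
  eₙ n = proj₁ (Ψ-partial²-mod-3 n)
  -- The error series of different partial products need not agree, so the diagonal is taken;
  -- multiplication by 3 acts coefficientwise, hence one coefficient of each suffices.
  e : PowerSeries
  e n = eₙ n n

-- The substitution of -z for z.

tail-⟨-z⟩ : ∀ f → tail (f ⟨-z⟩) ≗ scale -1ℤ (tail f ⟨-z⟩)
tail-⟨-z⟩ f n = ℤ.*-assoc -1ℤ (-1ℤ ℤ.^ n) (f (suc n))

⟨-z⟩-+ : ∀ f g → (f + g) ⟨-z⟩ ≗ f ⟨-z⟩ + g ⟨-z⟩
⟨-z⟩-+ f g n = ℤ.*-distribˡ-+ (-1ℤ ℤ.^ n) (f n) (g n)

⟨-z⟩-* : ∀ f g → (f * g) ⟨-z⟩ ≗ f ⟨-z⟩ * g ⟨-z⟩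
⟨-z⟩-* f g zero    = lemma (f 0) (g 0)
  where
  lemma : ∀ a b → 1ℤ ℤ.* (a ℤ.* b ℤ.+ 0ℤ) ≡ 1ℤ ℤ.* a ℤ.* (1ℤ ℤ.* b) ℤ.+ 0ℤ
  lemma = solve-∀
⟨-z⟩-* f g (suc n) = begin
  -1ℤ ℤ.* s ℤ.* (f 0 ℤ.* g (suc n) ℤ.+ (tail f * g) n)
    ≡⟨ lemma s (f 0) (g (suc n)) _ ⟩
  1ℤ ℤ.* f 0 ℤ.* (-1ℤ ℤ.* s ℤ.* g (suc n)) ℤ.+ -1ℤ ℤ.* (s ℤ.* (tail f * g) n)
    ≡⟨ cong (λ x → (f ⟨-z⟩) 0 ℤ.* (g ⟨-z⟩) (suc n) ℤ.+ x) (begin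
      -1ℤ ℤ.* ((tail f * g) ⟨-z⟩) n         ≡⟨ cong (-1ℤ ℤ.*_) (⟨-z⟩-* (tail f) g n) ⟩
      -1ℤ ℤ.* (tail f ⟨-z⟩ * g ⟨-z⟩) n      ≡⟨ scale-*ˡ -1ℤ (tail f ⟨-z⟩) (g ⟨-z⟩) n ⟨
      (scale -1ℤ (tail f ⟨-z⟩) * g ⟨-z⟩) n  ≡⟨ *-congʳ (g ⟨-z⟩) (tail-⟨-z⟩ f) n ⟨
      (tail (f ⟨-z⟩) * g ⟨-z⟩) n            ∎) ⟩
  (f ⟨-z⟩ * g ⟨-z⟩) (suc n) ∎
  where
  open ≡-Reasoning
  s = -1ℤ ℤ.^ n
  lemma : ∀ s a b c → -1ℤ ℤ.* s ℤ.* (a ℤ.* b ℤ.+ c) ≡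
                      1ℤ ℤ.* a ℤ.* (-1ℤ ℤ.* s ℤ.* b) ℤ.+ -1ℤ ℤ.* (s ℤ.* c)
  lemma = solve-∀

⟨-z⟩-con : ∀ c → con c ⟨-z⟩ ≗ con c
⟨-z⟩-con c zero    = ℤ.*-identityˡ c
⟨-z⟩-con c (suc n) = ℤ.*-zeroʳ (-1ℤ ℤ.^ suc n)

⟨-z⟩-z : z ⟨-z⟩ ≗ - z
⟨-z⟩-z zero          = refl
⟨-z⟩-z (suc zero)    = refl
⟨-z⟩-z (suc (suc n)) = ℤ.*-zeroʳ (-1ℤ ℤ.^ suc (suc n))

-- The substitution respects sums and products, fixes constants and negates z, so it transports
-- `Ψ²-mod-3`; the new error series is e(-z).
Ψ⟨-z⟩²-mod-3 : ∃ λ e → (con 1ℤ - z) * (Ψ ⟨-z⟩ * Ψ ⟨-z⟩) ≗ con 1ℤ + con (+ 3) * e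
Ψ⟨-z⟩²-mod-3 = e ⟨-z⟩ , (begin
  (con 1ℤ - z) * (Ψ ⟨-z⟩ * Ψ ⟨-z⟩)
    ≈⟨ *-cong (PS.+-cong (⟨-z⟩-con 1ℤ) ⟨-z⟩-z) (⟨-z⟩-* Ψ Ψ) ⟨
  (con 1ℤ ⟨-z⟩ + z ⟨-z⟩) * (Ψ * Ψ) ⟨-z⟩
    ≈⟨ *-congʳ ((Ψ * Ψ) ⟨-z⟩) (⟨-z⟩-+ (con 1ℤ) z) ⟨
  (con 1ℤ + z) ⟨-z⟩ * (Ψ * Ψ) ⟨-z⟩
    ≈⟨ ⟨-z⟩-* (con 1ℤ + z) (Ψ * Ψ) ⟨
  ((con 1ℤ + z) * (Ψ * Ψ)) ⟨-z⟩
    ≈⟨ (λ n → cong ((-1ℤ ℤ.^ n) ℤ.*_) (proj₂ Ψ²-mod-3 n)) ⟩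
  (con 1ℤ + con (+ 3) * e) ⟨-z⟩
    ≈⟨ ⟨-z⟩-+ (con 1ℤ) (con (+ 3) * e) ⟩
  con 1ℤ ⟨-z⟩ + (con (+ 3) * e) ⟨-z⟩
    ≈⟨ PS.+-cong (⟨-z⟩-con 1ℤ) (⟨-z⟩-* (con (+ 3)) e) ⟩
  con 1ℤ + con (+ 3) ⟨-z⟩ * e ⟨-z⟩
    ≈⟨ PS.+-congˡ {x = con 1ℤ} (*-congʳ (e ⟨-z⟩) (⟨-z⟩-con (+ 3))) ⟩
  con 1ℤ + con (+ 3) * e ⟨-z⟩ ∎)
  where
  open import Relation.Binary.Reasoning.Setoid PS.setoid
  e = proj₁ Ψ²-mod-3

-- Differentiation of power series.

-- The derivation z d/dz.
θ : PowerSeries → PowerSeries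
θ f n = + n ℤ.* f n

θ-* : ∀ f g → θ (f * g) ≗ θ f * g + f * θ g
θ-* f g zero    = lemma (f 0) (g 0)
  where
  lemma : ∀ a b → 0ℤ ℤ.* (a ℤ.* b ℤ.+ 0ℤ) ≡
                  0ℤ ℤ.* a ℤ.* b ℤ.+ 0ℤ ℤ.+ (a ℤ.* (0ℤ ℤ.* b) ℤ.+ 0ℤ)
  lemma = solve-∀
θ-* f g (suc n) = begin
  + suc n ℤ.* (f 0 ℤ.* g (suc n) ℤ.+ (tail f * g) n)
    ≡⟨ lemma (+ n) (f 0) (g (suc n)) _ ⟩
  f 0 ℤ.* θ g (suc n) ℤ.+ (θ (tail f * g) n ℤ.+ (tail f * g) n)
    ≡⟨ cong (λ x → f 0 ℤ.* θ g (suc n) ℤ.+ (x ℤ.+ (tail f * g) n)) (θ-* (tail f) g n) ⟩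
  f 0 ℤ.* θ g (suc n) ℤ.+ ((θ (tail f) * g) n ℤ.+ (tail f * θ g) n ℤ.+ (tail f * g) n)
    ≡⟨ lemma′ (f 0) (g (suc n)) (f 0 ℤ.* θ g (suc n)) ((θ (tail f) * g) n) ((tail f * θ g) n) _ ⟩
  0ℤ ℤ.* f 0 ℤ.* g (suc n) ℤ.+ ((θ (tail f) * g) n ℤ.+ (tail f * g) n) ℤ.+ (f * θ g) (suc n)
    ≡⟨ cong (λ x → 0ℤ ℤ.* f 0 ℤ.* g (suc n) ℤ.+ x ℤ.+ (f * θ g) (suc n)) (begin
      -- A coefficient of `tail f` has weight one higher in f, which accounts for the extra
      -- `tail f * g`.
      (θ (tail f) * g) n ℤ.+ (tail f * g) n  ≡⟨ *-distribʳ-+ g (θ (tail f)) (tail f) n ⟨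
      ((θ (tail f) + tail f) * g) n          ≡⟨ *-congʳ g tail-θ n ⟨
      (tail (θ f) * g) n                     ∎) ⟩
  (θ f * g + f * θ g) (suc n) ∎
  where
  open ≡-Reasoning
  tail-θ : tail (θ f) ≗ θ (tail f) + tail f
  tail-θ k = lemma″ (+ k) (f (suc k))
    where
    lemma″ : ∀ k a → (1ℤ ℤ.+ k) ℤ.* a ≡ k ℤ.* a ℤ.+ a
    lemma″ = solve-∀
  lemma : ∀ k a b c → (1ℤ ℤ.+ k) ℤ.* (a ℤ.* b ℤ.+ c) ≡
                      a ℤ.* ((1ℤ ℤ.+ k) ℤ.* b) ℤ.+ (k ℤ.* c ℤ.+ c)
  lemma = solve-∀
  lemma′ : ∀ a b c p q r → c ℤ.+ (p ℤ.+ q ℤ.+ r) ≡ 0ℤ ℤ.* a ℤ.* b ℤ.+ (p ℤ.+ r) ℤ.+ (c ℤ.+ q)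
  lemma′ = solve-∀

θ≗0⇒constant : ∀ f → θ f ≗ con 0ℤ → f ≗ con (f 0)
θ≗0⇒constant f θf≗0 zero    = refl
θ≗0⇒constant f θf≗0 (suc n) with ℤ.i*j≡0⇒i≡0∨j≡0 (+ suc n) (θf≗0 (suc n))
-- The alternative `+ suc n ≡ 0ℤ` is absurd and needs no clause.
... | inj₂ f≡0 = f≡0

-- The generating function of the central binomial coefficients.

centralBinomial : PowerSeries
centralBinomial n = + ((2 ℕ.* n) C n)

2nCn*n!n! : ∀ n → ((2 ℕ.* n) C n) ℕ.* (n ! ℕ.* n !) ≡ (2 ℕ.* n) !
2nCn*n!n! n = begin
  ((2 ℕ.* n) C n) ℕ.* (n ! ℕ.* n !)
    ≡⟨ cong (λ k → ((2 ℕ.* n) C n) ℕ.* (n ! ℕ.* k !)) 2n∸n≡n ⟨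
  ((2 ℕ.* n) C n) ℕ.* (n ! ℕ.* (2 ℕ.* n ℕ.∸ n) !)
    ≡⟨ cong (ℕ._* (n ! ℕ.* (2 ℕ.* n ℕ.∸ n) !)) (nCk≡n!/k![n-k]! n≤2n) ⟩
  _ ≡⟨ m/n*n≡m {{n ℕ.!* (2 ℕ.* n ℕ.∸ n) !≢0}} (k![n∸k]!∣n! n≤2n) ⟩
  (2 ℕ.* n) ! ∎
  where
  open ≡-Reasoning
  n≤2n : n ℕ.≤ 2 ℕ.* n
  n≤2n = ℕ.m≤m+n n _
  2n∸n≡n : 2 ℕ.* n ℕ.∸ n ≡ n
  2n∸n≡n = trans (ℕ.m+n∸m≡n n (n ℕ.+ 0)) (ℕ.+-identityʳ n)

-- Multiplied by (n + 1) n!², both sides become (2n + 2)!, by the factorial formula at n + 1 and at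
-- n respectively.
2nCn-recurrence : ∀ n →
  suc n ℕ.* ((2 ℕ.* suc n) C suc n) ≡ 2 ℕ.* (1 ℕ.+ 2 ℕ.* n) ℕ.* ((2 ℕ.* n) C n)
2nCn-recurrence n = ℕ.*-cancelʳ-≡ _ _ (suc n ℕ.* (n ! ℕ.* n !)) {{nonZero}} (begin
  suc n ℕ.* b ℕ.* (suc n ℕ.* (n ! ℕ.* n !))
    ≡⟨ regroup (suc n) b (n !) ⟩
  b ℕ.* (suc n ! ℕ.* suc n !)
    ≡⟨ 2nCn*n!n! (suc n) ⟩
  (2 ℕ.* suc n) !
    ≡⟨ cong _! (ℕ.*-suc 2 n) ⟩
  (2 ℕ.+ 2 ℕ.* n) ℕ.* ((1 ℕ.+ 2 ℕ.* n) ℕ.* (2 ℕ.* n) !)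
    ≡⟨ cong (λ x → (2 ℕ.+ 2 ℕ.* n) ℕ.* ((1 ℕ.+ 2 ℕ.* n) ℕ.* x)) (2nCn*n!n! n) ⟨
  (2 ℕ.+ 2 ℕ.* n) ℕ.* ((1 ℕ.+ 2 ℕ.* n) ℕ.* (a ℕ.* (n ! ℕ.* n !)))
    ≡⟨ regroup′ n a (n !) ⟩
  2 ℕ.* (1 ℕ.+ 2 ℕ.* n) ℕ.* a ℕ.* (suc n ℕ.* (n ! ℕ.* n !)) ∎)
  where
  open ≡-Reasoning
  a = (2 ℕ.* n) C n
  b = (2 ℕ.* suc n) C suc n
  nonZero : ℕ.NonZero (suc n ℕ.* (n ! ℕ.* n !))
  nonZero = ℕ.m*n≢0 (suc n) (n ! ℕ.* n !) {{_}} {{n ℕ.!* n !≢0}}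
  regroup : ∀ k b x → k ℕ.* b ℕ.* (k ℕ.* (x ℕ.* x)) ≡ b ℕ.* (k ℕ.* x ℕ.* (k ℕ.* x))
  regroup = ℕ-Solver.solve-∀
  regroup′ : ∀ n a x → (2 ℕ.+ 2 ℕ.* n) ℕ.* ((1 ℕ.+ 2 ℕ.* n) ℕ.* (a ℕ.* (x ℕ.* x))) ≡
                       2 ℕ.* (1 ℕ.+ 2 ℕ.* n) ℕ.* a ℕ.* ((1 ℕ.+ n) ℕ.* (x ℕ.* x))
  regroup′ = ℕ-Solver.solve-∀

-- At z^(n+1) this is the recurrence with 4n times the n-th coefficient subtracted: 2 (2n + 1) - 4n
-- = 2.
centralBinomial-ODE :
  (con 1ℤ - con (+ 4) * z) * θ centralBinomial ≗ con (+ 2) * (z * centralBinomial)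
centralBinomial-ODE zero    = refl
centralBinomial-ODE (suc n) = begin
  ((con 1ℤ - con (+ 4) * z) * θ centralBinomial) (suc n)
    ≡⟨ [1-4z]*f z (θ centralBinomial) (suc n) ⟩
  θ centralBinomial (suc n) ℤ.- (con (+ 4) * (z * θ centralBinomial)) (suc n)
    ≡⟨ cong₂ ℤ._-_ recurrence (trans (con-* (+ 4) (z * θ centralBinomial) (suc n))
         (cong (+ 4 ℤ.*_) (z*f-suc (θ centralBinomial) n))) ⟩
  + 2 ℤ.* (1ℤ ℤ.+ + 2 ℤ.* + n) ℤ.* a ℤ.- + 4 ℤ.* (+ n ℤ.* a)
    ≡⟨ lemma (+ n) a ⟩
  + 2 ℤ.* a
    ≡⟨ trans (con-* (+ 2) (z * centralBinomial) (suc n))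
         (cong (+ 2 ℤ.*_) (z*f-suc centralBinomial n)) ⟨
  (con (+ 2) * (z * centralBinomial)) (suc n) ∎
  where
  open ≡-Reasoning
  a = centralBinomial n
  lemma : ∀ k a → + 2 ℤ.* (1ℤ ℤ.+ + 2 ℤ.* k) ℤ.* a ℤ.- + 4 ℤ.* (k ℤ.* a) ≡ + 2 ℤ.* a
  lemma = solve-∀
  recurrence : + suc n ℤ.* centralBinomial (suc n) ≡ + 2 ℤ.* (1ℤ ℤ.+ + 2 ℤ.* + n) ℤ.* a
  recurrence = begin
    + suc n ℤ.* centralBinomial (suc n)             ≡⟨ ℤ.pos-* (suc n) _ ⟨
    + (suc n ℕ.* ((2 ℕ.* suc n) C suc n))           ≡⟨ cong +_ (2nCn-recurrence n) ⟩
    + (2 ℕ.* (1 ℕ.+ 2 ℕ.* n) ℕ.* ((2 ℕ.* n) C n))   ≡⟨ ℤ.pos-* (2 ℕ.* (1 ℕ.+ 2 ℕ.* n)) _ ⟩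
    + (2 ℕ.* (1 ℕ.+ 2 ℕ.* n)) ℤ.* a                 ≡⟨ cong (ℤ._* a) (ℤ.pos-* 2 (1 ℕ.+ 2 ℕ.* n)) ⟩
    + 2 ℤ.* (1ℤ ℤ.+ + (2 ℕ.* n)) ℤ.* a              ≡⟨ cong (λ x → + 2 ℤ.* (1ℤ ℤ.+ x) ℤ.* a) (ℤ.pos-* 2 n) ⟩
    + 2 ℤ.* (1ℤ ℤ.+ + 2 ℤ.* + n) ℤ.* a              ∎

centralBinomial² : (con 1ℤ - con (+ 4) * z) * (centralBinomial * centralBinomial) ≗ con 1ℤ
-- The constant term computes to 1.
centralBinomial² = θ≗0⇒constant _ (begin
  θ (c * (F * F))
    ≈⟨ θ-* c (F * F) ⟩
  θ c * (F * F) + c * θ (F * F)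
    ≈⟨ PS.+-cong (*-congʳ (F * F) θc) (*-congˡ c (θ-* F F)) ⟩
  - (con (+ 4) * z) * (F * F) + c * (θ F * F + F * θ F)
    ≈⟨ derivative-of-[1-4z]f² z F (θ F) centralBinomial-ODE ⟩
  con 0ℤ ∎)
  where
  open import Relation.Binary.Reasoning.Setoid PS.setoid
  F = centralBinomial
  c = con 1ℤ - con (+ 4) * z
  4z : ∀ n → (con (+ 4) * z) (suc (suc n)) ≡ 0ℤ
  4z n = con-* (+ 4) z (suc (suc n))
  θc : θ c ≗ - (con (+ 4) * z)
  θc zero          = refl
  θc (suc zero)    = refl
  θc (suc (suc n)) rewrite 4z n = ℤ.*-zeroʳ (+ suc (suc n))

-- Cancellation modulo an integer.

∣-*-≤ : ∀ {k} f g n → (∀ {j} → j ℕ.≤ n → k Signed.∣ g j) → k Signed.∣ (f * g) n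
∣-*-≤ f g zero    k∣g = Signed.∣m∣n⇒∣m+n (Signed.∣n⇒∣m*n (f 0) (k∣g ℕ.z≤n)) (Signed.divides 0ℤ refl)
∣-*-≤ f g (suc n) k∣g = Signed.∣m∣n⇒∣m+n (Signed.∣n⇒∣m*n (f 0) (k∣g ℕ.≤-refl))
  (∣-*-≤ (tail f) g n (k∣g ∘ ℕ.m≤n⇒m≤1+n))

-- By strong induction: coefficient n of f g is f 0 · g n plus a combination of earlier coefficients
-- of g, already divisible by k, so k divides f 0 · g n and f 0 cancels.
*-cancelˡ-∣ : ∀ {k} f g → Coprime k (f 0) → (∀ n → k ∣ (f * g) n) → ∀ n → k ∣ g n
*-cancelˡ-∣ {k} f g coprime k∣fg = <-rec _ step
  where
  step : ∀ n → (∀ {j} → j ℕ.< n → k ∣ g j) → k ∣ g n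
  step zero    _   = coprime-divisor k (f 0) (g 0) coprime
    (subst (k ∣_) (ℤ.+-identityʳ (f 0 ℤ.* g 0)) (k∣fg 0))
  step (suc n) rec = coprime-divisor k (f 0) (g (suc n)) coprime (Signed.∣⇒∣ᵤ
    (Signed.∣m+n∣n⇒∣m {m = f 0 ℤ.* g (suc n)} (Signed.∣ᵤ⇒∣ {k} (k∣fg (suc n)))
      (∣-*-≤ (tail f) g n (λ {j} j≤n → Signed.∣ᵤ⇒∣ {k} {g j} (rec (ℕ.s≤s j≤n))))))

theorem12p2 : (λ n → + ((2 ℕ.* n) C n))
    ≈ (con (+ 9) * ((con (+ 1) + z) * 1/[1-z]) + con (+ 3)) * Ψ ⟨-z⟩
    - (con (+ 4) * z + con (+ 8)) * (Ψ ⟨-z⟩) ^ 3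
    - (con (+ 12) * z^ 2 + con (+ 12) * z + con (+ 3)) * (Ψ ⟨-z⟩) ^ 5
    ⟨mod 27 ⟩
theorem12p2 = *-cancelˡ-∣ {+ 27} unit (centralBinomial - G)
  -- G has constant term 9 + 3 - 8 - 3 = 1, so `unit 0` evaluates to 2 and coprimality is decided by
  -- computation.
  (toWitness {a? = coprime? (+ 27) (unit 0)} _)
  (λ n → Signed.∣⇒∣ᵤ (Signed.divides (quotient n) (begin
    (unit * (centralBinomial - G)) n
      ≡⟨ cleared-difference-of-squares z (z^ 2) 1/[1-z] (Ψ ⟨-z⟩) centralBinomial e
           (PS.sym (z^-+ 1 1)) [1-z]*1/[1-z] (proj₂ Ψ⟨-z⟩²-mod-3) centralBinomial² n ⟩
    (con (+ 27) * quotient) n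
      ≡⟨ con-* (+ 27) quotient n ⟩
    + 27 ℤ.* quotient n
      ≡⟨ ℤ.*-comm (+ 27) (quotient n) ⟩
    quotient n ℤ.* + 27 ∎)))
  where
  open ≡-Reasoning
  e = proj₁ Ψ⟨-z⟩²-mod-3
  G = combination z (z^ 2) 1/[1-z] (Ψ ⟨-z⟩)
  quotient = cofactor z e
  1-z = con 1ℤ - z
  unit = (con 1ℤ - con (+ 4) * z) * (centralBinomial + G) * (1-z * (1-z * 1-z * (1-z * 1-z)))
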